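{- (i) If $D$ is a connected digraph with $\alpha(D)\le 2$, then $D$ contains a Hamilton orpath with at most two backward arcs. (ii) There is a connected digraph $D$ with $\alpha(D)\le 2$ which has no Hamilton orpath with less than two backward arcs.
   Context: Digraphs are finite, without loops or parallel arcs; two opposite arcs $xy$, $yx$ may both be present. $D$ has vertex set $V(D)$ and arc set $A(D)$. $D$ is connected if its underlying undirected multigraph $UG(D)$ (replace each arc $xy$ by an edge between $x$ and $y$) is connected. The independence number $\alpha(D)$ is the maximum integer $k$ such that $D$ has $k$ vertices with no arc between any two of them. An orpath (oriented path) in $D$ is a sequence $P=x_1x_2\dots x_p$ of distinct vertices such that for every $i\in\{1,\dots,p-1\}$ at least one of $x_ix_{i+1}$, $x_{i+1}x_i$ is in $A(D)$. If $x_ix_{i+1}\in A(D)$, then $x_ix_{i+1}$ is a forward arc of $P$; otherwise $x_{i+1}x_i$ is a backward arc of $P$. Thus the number of backward arcs of $P$ is the number of $i\in\{1,\dots,p-1\}$ with $x_ix_{i+1}\notin A(D)$. An orpath is Hamilton if it contains all vertices of $D$. -}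

module Defs where

open import Data.Bool.Base using (if_then_else_)
open import Data.Fin.Base using (Fin)
open import Data.Fin.Properties using (all?)
open import Data.Fin.Subset using (Subset; ∣_∣) renaming (_∈_ to _∈ₛ_)
open import Data.Fin.Subset.Properties using (anySubset?; _∈?_)
open import Data.List.Base using (List; []; _∷_; filter; upTo)
open import Data.List.Extrema.Nat using (max)
open import Data.List.Membership.Propositional using (_∈_)
open import Data.List.Relation.Unary.Linked using (Linked)
open import Data.List.Relation.Unary.Unique.Propositional using (Unique)
open import Data.Nat.Base using (ℕ; suc; _+_)
open import Data.Nat.Properties using (_≟_)
open import Data.Product.Base using (_×_; ∃-syntax)
open import Level using (0ℓ)
open import Relation.Binary.Construct.Closure.ReflexiveTransitive using (Star)
open import Relation.Binary.Construct.Closure.Symmetric using (SymClosure)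
open import Relation.Binary.Core using (Rel)
open import Relation.Binary.Definitions using (Decidable; Irreflexive)
open import Relation.Binary.PropositionalEquality.Core using (_≡_)
open import Relation.Nullary.Decidable
  using (Dec; does; ¬?; _×-dec_; _→-dec_)
open import Relation.Nullary.Negation.Core using (¬_)

-- Arcs form a relation, so there are no parallel arcs; x ⟶ y and y ⟶ x may
-- both hold.  The digraph without vertices is not excluded.
record Digraph : Set₁ where
  infix 4 _⟶_ _⟶?_
  field
    order  : ℕ
    _⟶_    : Rel (Fin order) 0ℓ
    _⟶?_   : Decidable _⟶_
    irrefl : Irreflexive _≡_ _⟶_

  Vertex : Set
  Vertex = Fin order

module _ (D : Digraph) where
  open Digraph D

  -- The edge relation of the underlying undirected multigraph.
  Adjacent : Rel Vertex 0ℓ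
  Adjacent = SymClosure _⟶_

  Connected : Set
  Connected = ∀ x y → Star Adjacent x y

  -- Both x ⟶ y and y ⟶ x are excluded, since x and y range over all
  -- ordered pairs; the case x ≡ y is harmless by irreflexivity.
  Independent : Subset order → Set
  Independent S = ∀ x y → x ∈ₛ S → y ∈ₛ S → ¬ (x ⟶ y)

  independent? : ∀ S → Dec (Independent S)
  independent? S = all? λ x → all? λ y →
    (x ∈? S) →-dec ((y ∈? S) →-dec ¬? (x ⟶? y))

  HasIndependent : ℕ → Set
  HasIndependent k = ∃[ S ] (Independent S × ∣ S ∣ ≡ k)

  hasIndependent? : ∀ k → Dec (HasIndependent k)
  hasIndependent? k = anySubset? λ S → independent? S ×-dec (∣ S ∣ ≟ k)

  -- The candidates are k = 0, …, order, since no vertex set is larger.  The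
  -- default value 0 of max is itself attained, by the empty set.
  α : ℕ
  α = max 0 (filter hasIndependent? (upTo (suc order)))

  record Orpath : Set where
    field
      vertices : List Vertex
      distinct : Unique vertices
      linked   : Linked Adjacent vertices

  open Orpath

  -- A consecutive pair x , y counts as backward only when x ⟶ y fails, even
  -- if y ⟶ x also holds.
  countBackward : List Vertex → ℕ
  countBackward []           = 0
  countBackward (x ∷ [])     = 0
  countBackward (x ∷ y ∷ xs) =
    (if does (x ⟶? y) then 0 else 1) + countBackward (y ∷ xs)

  backwardArcs : Orpath → ℕ
  backwardArcs P = countBackward (vertices P)

  Hamilton : Orpath → Set
  Hamilton P = ∀ x → x ∈ vertices P

-- (i) By Gallai–Milgram the vertices are covered by at most two disjoint dipaths
-- A = a … a′ and B = b … b′.  Keep them as the two middle parts of dipaths S A T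
-- and S B T, with S and T both empty at first and both nonempty later, and apply
-- α ≤ 2 to the ends.
--   * With S, T nonempty, either an end of S or T closes up S A T and B, or
--     S B T and A, into a Hamilton orpath with one backward arc, or else a ~ b
--     and a′ ~ b′.
--   * With S, T empty, either A and B can be concatenated with one backward arc;
--     or a ~ b and a′ ~ b′; or each of A, B is a single vertex or has adjacent
--     ends.  In the last case connectedness gives an arc between A and B, and
--     both can be rotated to meet at it, at the cost of one backward arc each.
-- If a ~ b and a′ ~ b′: an arc a ⟶ b gives the cover A − a, S a B T with a shorter
-- first dipath, and dually for b′ ⟶ a′; otherwise b ⟶ a and a′ ⟶ b′, so b moves to
-- S and b′ to T, and B gets shorter.
-- (ii) Two transitive triangles joined by an arc between their middle vertices:
-- a Hamilton orpath has to end its first triangle and begin its second one at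
-- the middle vertex, which costs a backward arc in each.
module Submission where

open import Defs
open import Data.Bool.Base using (Bool; true; false; T)
open import Data.Bool.Properties using (T?)
open import Data.Fin.Base using (Fin)
open import Data.Fin.Patterns
open import Data.Fin.Properties using (injective⇒≤) renaming (_≟_ to _≟ᶠ_)
open import Data.Fin.Subset using (∣_∣; ⁅_⁆; _∪_; _⊂_) renaming (_∈_ to _∈ₛ_)
open import Data.Fin.Subset.Properties
  using (x∈⁅x⁆; x∈⁅y⁆⇒x≡y; x∈p∪q⁻; x∈p∪q⁺; p⊂q⇒∣p∣<∣q∣; ∣⁅x⁆∣≡1; ∣p∣≤n)
open import Data.List.Base
  using (List; []; _∷_; [_]; _++_; length; filter; allFin; cartesianProductWith)
open import Data.List.Extrema.Nat using (xs≤max)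
open import Data.List.Membership.Propositional using (_∈_)
open import Data.List.Membership.Propositional.Properties
  using (∈-allFin; ∈-filter⁺; ∈-upTo⁺; ∈-++⁺ˡ; ∈-++⁺ʳ; ∈-++⁻; ∈-cartesianProductWith⁺)
open import Data.List.Membership.Setoid.Properties using (index-injective)
open import Data.List.Properties using (++-identityʳ; length-++)
open import Data.List.Relation.Binary.Permutation.Propositional
  using (_↭_; ↭-refl; ↭-sym; ↭-trans; ↭-prep; ↭-reflexive; ↭⇒↭ₛ)
open import Data.List.Relation.Binary.Permutation.Propositional.Properties
  using (++-commutativeMonoid; ∈-resp-↭; ↭-length; ++-comm; shift; ++⁺)
import Data.List.Relation.Binary.Permutation.Setoid.Properties as ↭ₛ
import Data.List.Relation.Unary.All as All
open import Data.List.Relation.Unary.AllPairs.Core using ([]; _∷_)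
open import Data.List.Relation.Unary.Any using (here; there; index)
open import Data.List.Relation.Unary.Linked as Linked using (Linked; []; [-]; _∷_; linked?)
open import Data.List.Relation.Unary.Unique.Propositional using (Unique)
open import Data.List.Relation.Unary.Unique.Propositional.Properties using (allFin⁺)
open import Data.Nat.Base using (ℕ; zero; suc; _+_; _≤_; _<_; z≤n; s≤s; s≤s⁻¹)
open import Data.Nat.Properties
  using (≤-refl; ≤-trans; ≤-reflexive; m≤n+m; m≤n⇒m≤1+n; m≤n⇒m<n∨m≡n; n≤1+n; <⇒≱;
         suc-injective; +-comm; _≤?_; _<?_)
open import Data.Product.Base using (_×_; _,_; proj₂; ∃-syntax)
open import Data.Sum.Base as Sum using (_⊎_; inj₁; inj₂)
open import Data.Unit.Base using (tt)
open import Relation.Binary.Construct.Closure.ReflexiveTransitive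
  using (Star; ε; _◅_; _◅◅_; reverse)
open import Relation.Binary.Construct.Closure.Symmetric using (fwd; bwd; symmetric)
open import Relation.Binary.PropositionalEquality
  using (_≡_; _≢_; refl; sym; trans; cong; setoid; subst)
open import Relation.Nullary.Decidable using (Dec; yes; no; toWitness; _×-dec_)
open import Relation.Nullary.Negation.Core using (¬_; contradiction)

-- Disjointness and rearrangement of vertex lists.

Unique-++⇒≢ : ∀ {A : Set} {x y : A} {xs ys} → Unique (xs ++ ys) → x ∈ xs → y ∈ ys → x ≢ y
Unique-++⇒≢ {xs = _ ∷ xs} (px ∷ _) (here refl) y∈ = All.lookup px (∈-++⁺ʳ xs y∈)
Unique-++⇒≢ (_ ∷ u) (there x∈) y∈ = Unique-++⇒≢ u x∈ y∈

Unique-++ʳ : ∀ {A : Set} xs {ys : List A} → Unique (xs ++ ys) → Unique ys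
Unique-++ʳ []       u       = u
Unique-++ʳ (_ ∷ xs) (_ ∷ u) = Unique-++ʳ xs u

length-init : ∀ {A : Set} {y : A} xs {n} → length (xs ++ [ y ]) ≤ suc n → length xs ≤ n
length-init xs le = s≤s⁻¹ (≤-trans (≤-reflexive (trans (+-comm 1 _) (sym (length-++ xs)))) le)

Unique-resp-↭ : ∀ {A : Set} {xs ys : List A} → xs ↭ ys → Unique xs → Unique ys
Unique-resp-↭ p = ↭ₛ.Unique-resp-↭ (setoid _) (↭⇒↭ₛ p)

⊂⁅⁆∪ : ∀ {n} {x : Fin n} {S} → ¬ (x ∈ₛ S) → S ⊂ ⁅ x ⁆ ∪ S
⊂⁅⁆∪ {x = x} x∉ = (λ y∈ → x∈p∪q⁺ (inj₂ y∈)) , x , x∈p∪q⁺ (inj₁ (x∈⁅x⁆ x)) , x∉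

module _ (D : Digraph) where
  open Digraph D
  open import Algebra.Solver.CommutativeMonoid (++-commutativeMonoid {A = Vertex})
    using (solve; _⊜_; _⊕_; id)

  -- Adjacency and the independence number.

  infix 4 _~_
  _~_ : Vertex → Vertex → Set
  _~_ = Adjacent D

  ~-sym : ∀ {x y} → x ~ y → y ~ x
  ~-sym = symmetric _⟶_

  Adjacent? : ∀ x y → Dec (x ~ y)
  Adjacent? x y with x ⟶? y | y ⟶? x
  ... | yes p | _     = yes (fwd p)
  ... | no _  | yes q = yes (bwd q)
  ... | no ¬p | no ¬q = no λ { (fwd p) → ¬p p ; (bwd q) → ¬q q }

  independent⇒≤α : ∀ S → Independent D S → ∣ S ∣ ≤ α D
  independent⇒≤α S ind = All.lookup (xs≤max 0 _)
    (∈-filter⁺ (hasIndependent? D) (∈-upTo⁺ (s≤s (∣p∣≤n S))) (S , ind , refl))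

  triple-adjacent : α D ≤ 2 → ∀ {x y z} → x ≢ y → x ≢ z → y ≢ z → x ~ y ⊎ x ~ z ⊎ y ~ z
  triple-adjacent α≤2 {x} {y} {z} x≢y x≢z y≢z
    with Adjacent? x y | Adjacent? x z | Adjacent? y z
  ... | yes p | _     | _     = inj₁ p
  ... | no _  | yes p | _     = inj₂ (inj₁ p)
  ... | no _  | no _  | yes p = inj₂ (inj₂ p)
  ... | no ¬p | no ¬q | no ¬r =
    contradiction (≤-trans (independent⇒≤α S ind) α≤2) (<⇒≱ 2<∣S∣)
    where
    S = ⁅ x ⁆ ∪ (⁅ y ⁆ ∪ ⁅ z ⁆)

    elements : ∀ {v} → v ∈ₛ S → v ≡ x ⊎ v ≡ y ⊎ v ≡ z
    elements v∈ = Sum.map (x∈⁅y⁆⇒x≡y _)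
      (λ v∈′ → Sum.map (x∈⁅y⁆⇒x≡y _) (x∈⁅y⁆⇒x≡y _) (x∈p∪q⁻ _ _ v∈′)) (x∈p∪q⁻ _ _ v∈)

    2<∣S∣ : 2 < ∣ S ∣
    -- The size is read off the strict chain {z} ⊂ {y, z} ⊂ {x, y, z}.
    2<∣S∣ = ≤-trans (s≤s (≤-trans (s≤s (≤-reflexive (sym (∣⁅x⁆∣≡1 z))))
        (p⊂q⇒∣p∣<∣q∣ (⊂⁅⁆∪ λ y∈ → y≢z (x∈⁅y⁆⇒x≡y _ y∈)))))
      (p⊂q⇒∣p∣<∣q∣ (⊂⁅⁆∪ λ x∈ →
        Sum.[ (λ e → x≢y (x∈⁅y⁆⇒x≡y _ e)) , (λ e → x≢z (x∈⁅y⁆⇒x≡y _ e)) ] (x∈p∪q⁻ _ _ x∈)))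

    ind : Independent D S
    ind u v u∈ v∈ a with elements u∈ | elements v∈
    ... | inj₁ refl        | inj₁ refl        = irrefl refl a
    ... | inj₁ refl        | inj₂ (inj₁ refl) = ¬p (fwd a)
    ... | inj₁ refl        | inj₂ (inj₂ refl) = ¬q (fwd a)
    ... | inj₂ (inj₁ refl) | inj₁ refl        = ¬p (bwd a)
    ... | inj₂ (inj₁ refl) | inj₂ (inj₁ refl) = irrefl refl a
    ... | inj₂ (inj₁ refl) | inj₂ (inj₂ refl) = ¬r (fwd a)
    ... | inj₂ (inj₂ refl) | inj₁ refl        = ¬q (bwd a)
    ... | inj₂ (inj₂ refl) | inj₂ (inj₁ refl) = ¬r (bwd a)
    ... | inj₂ (inj₂ refl) | inj₂ (inj₂ refl) = irrefl refl a

  -- Orpaths with a budget of backward arcs.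

  infixr 5 _∷_ _∷~_

  -- Trail k x y xs: xs is an orpath from x to y (up to distinctness of its
  -- vertices) with at most k backward arcs.
  data Trail : ℕ → Vertex → Vertex → List Vertex → Set where
    point : ∀ {k} x → Trail k x x [ x ]
    _∷_   : ∀ {k x y z xs} → x ⟶ y → Trail k y z xs → Trail k x z (x ∷ xs)
    _∷~_  : ∀ {k x y z xs} → x ~ y → Trail k y z xs → Trail (suc k) x z (x ∷ xs)

  Dipath : Vertex → Vertex → List Vertex → Set
  Dipath = Trail 0

  weaken : ∀ {k l x y xs} → k ≤ l → Trail k x y xs → Trail l x y xs
  weaken k≤l       (point x) = point x
  weaken k≤l       (a ∷ p)   = a ∷ weaken k≤l p
  weaken (s≤s k≤l) (a ∷~ p)  = a ∷~ weaken k≤l p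

  infixr 5 _⟨_⟩_ _⟨_⟩~_

  _⟨_⟩_ : ∀ {k l x y z w xs ys} →
    Trail k x y xs → y ⟶ z → Trail l z w ys → Trail (k + l) x w (xs ++ ys)
  point _  ⟨ b ⟩ q = b ∷ weaken (m≤n+m _ _) q
  (a ∷ p)  ⟨ b ⟩ q = a ∷ (p ⟨ b ⟩ q)
  (a ∷~ p) ⟨ b ⟩ q = a ∷~ (p ⟨ b ⟩ q)

  _⟨_⟩~_ : ∀ {k l x y z w xs ys} →
    Trail k x y xs → y ~ z → Trail l z w ys → Trail (suc (k + l)) x w (xs ++ ys)
  point _  ⟨ b ⟩~ q = b ∷~ weaken (m≤n+m _ _) q
  (a ∷ p)  ⟨ b ⟩~ q = a ∷ (p ⟨ b ⟩~ q)
  (a ∷~ p) ⟨ b ⟩~ q = a ∷~ (p ⟨ b ⟩~ q)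

  start∈ : ∀ {k x y xs} → Trail k x y xs → x ∈ xs
  start∈ (point _) = here refl
  start∈ (_ ∷ _)   = here refl
  start∈ (_ ∷~ _)  = here refl

  end∈ : ∀ {k x y xs} → Trail k x y xs → y ∈ xs
  end∈ (point _) = here refl
  end∈ (_ ∷ p)   = there (end∈ p)
  end∈ (_ ∷~ p)  = there (end∈ p)

  uncons : ∀ {k x y xs} → Trail k x y xs → ∃[ ys ] xs ≡ x ∷ ys
  uncons (point _) = _ , refl
  uncons (_ ∷ _)   = _ , refl
  uncons (_ ∷~ _)  = _ , refl

  trail⇒linked : ∀ {k x y xs} → Trail k x y xs → Linked _~_ xs
  trail⇒linked (point _)  = [-]
  trail⇒linked (a ∷ p)  with uncons p | trail⇒linked p
  ... | _ , refl | l = fwd a ∷ l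
  trail⇒linked (a ∷~ p) with uncons p | trail⇒linked p
  ... | _ , refl | l = a ∷ l

  trail⇒countBackward : ∀ {k x y xs} → Trail k x y xs → countBackward D xs ≤ k
  trail⇒countBackward (point _) = z≤n
  trail⇒countBackward {x = x} (_∷_ {y = y} a p) with uncons p | trail⇒countBackward p
  ... | _ , refl | le with x ⟶? y
  ...   | yes _ = le
  ...   | no ¬a = contradiction a ¬a
  trail⇒countBackward {x = x} (_∷~_ {y = y} a p) with uncons p | trail⇒countBackward p
  ... | _ , refl | le with x ⟶? y
  -- An edge that was charged as backward may be a forward arc after all.
  ...   | yes _ = m≤n⇒m≤1+n le
  ...   | no _  = s≤s le

  Spanned : ℕ → List Vertex → Set
  Spanned k vs = ∃[ x ] ∃[ y ] ∃[ xs ] (Trail k x y xs × xs ↭ vs)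

  data InitLast (x y : Vertex) : List Vertex → Set where
    single : x ≡ y → InitLast x y [ y ]
    snoc   : ∀ {z xs} → Dipath x z xs → z ⟶ y → InitLast x y (xs ++ [ y ])

  initLast : ∀ {x y xs} → Dipath x y xs → InitLast x y xs
  initLast (point _) = single refl
  initLast (a ∷ p) with initLast p
  ... | single refl = snoc (point _) a
  ... | snoc q b    = snoc (a ∷ q) b

  data Peeled (x y : Vertex) : List Vertex → Set where
    one  : x ≡ y → Peeled x y [ x ]
    two  : x ⟶ y → Peeled x y (x ∷ [ y ])
    many : ∀ {x′ y′ ms} → x ⟶ x′ → Dipath x′ y′ ms → y′ ⟶ y → Peeled x y (x ∷ ms ++ [ y ])

  peel : ∀ {x y xs} → Dipath x y xs → Peeled x y xs
  peel (point _) = one refl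
  peel (a ∷ p) with initLast p
  ... | single refl = two a
  ... | snoc q b    = many a q b

  -- Gallai-Milgram: a cover by at most two dipaths.

  record TwoDipaths (x y : Vertex) (vs : List Vertex) : Set where
    constructor twoDipaths
    field
      {x′ y′}  : Vertex
      {xs ys}  : List Vertex
      fst      : Dipath x x′ xs
      snd      : Dipath y y′ ys
      cover    : xs ++ ys ↭ vs

  twoDipaths-swap : ∀ {x y vs} → TwoDipaths x y vs → TwoDipaths y x vs
  twoDipaths-swap (twoDipaths {xs = xs} {ys} p q c) = twoDipaths q p (↭-trans (++-comm ys xs) c)

  consˡ : ∀ {a x y vs} → a ⟶ x → TwoDipaths x y vs → TwoDipaths a y (a ∷ vs)
  consˡ a⟶x (twoDipaths p q c) = twoDipaths (a⟶x ∷ p) q (↭-prep _ c)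

  cover-resp-↭ : ∀ {x y vs ws} → vs ↭ ws → TwoDipaths x y vs → TwoDipaths x y ws
  cover-resp-↭ r (twoDipaths p q c) = twoDipaths p q (↭-trans c r)

  OnTwoOf : Vertex → Vertex → Vertex → List Vertex → Set
  OnTwoOf a b c vs = TwoDipaths a b vs ⊎ TwoDipaths a c vs ⊎ TwoDipaths b c vs

  swap₁₂ : ∀ {a b c vs} → OnTwoOf a b c vs → OnTwoOf b a c vs
  swap₁₂ = Sum.map twoDipaths-swap Sum.swap

  swap₂₃ : ∀ {a b c vs} → OnTwoOf a b c vs → OnTwoOf a c b vs
  swap₂₃ (inj₁ t)        = inj₂ (inj₁ t)
  swap₂₃ (inj₂ (inj₁ t)) = inj₁ t
  swap₂₃ (inj₂ (inj₂ t)) = inj₂ (inj₂ (twoDipaths-swap t))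

  -- The two resulting starts are required to be among the three given ones. This strengthening
  -- carries the induction: a deleted start can be put back only in front of a known vertex.
  ThreeReduce : ℕ → Set
  ThreeReduce n = ∀ {a a′ b b′ c c′ as bs cs vs} → length vs ≡ n → Unique vs →
    Dipath a a′ as → Dipath b b′ bs → Dipath c c′ cs → as ++ bs ++ cs ↭ vs → OnTwoOf a b c vs

  -- Gallai–Milgram: after deleting a, the new starts are a₂, b, c; whichever
  -- two of them survive, one has an arc from a and the other is b or c.
  reduce-arc : ∀ {n} → ThreeReduce n → ∀ {a a′ b b′ c c′ as bs cs vs} → a ⟶ b →
    length vs ≡ suc n → Unique vs →
    Dipath a a′ as → Dipath b b′ bs → Dipath c c′ cs → as ++ bs ++ cs ↭ vs → OnTwoOf a b c vs
  reduce-arc ih a⟶b len u (point _) q r π = inj₂ (inj₁ (twoDipaths (a⟶b ∷ q) r π))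
  reduce-arc ih a⟶b len u (a⟶x ∷ p) q r π with Unique-resp-↭ (↭-sym π) u
  ... | _ ∷ u′ with ih (suc-injective (trans (↭-length π) len)) u′ p q r ↭-refl
  ...   | inj₁ t        = inj₁ (cover-resp-↭ π (consˡ a⟶x t))
  ...   | inj₂ (inj₁ t) = inj₂ (inj₁ (cover-resp-↭ π (consˡ a⟶x t)))
  ...   | inj₂ (inj₂ t) = inj₂ (inj₁ (cover-resp-↭ π (consˡ a⟶b t)))

  module _ (α≤2 : α D ≤ 2) where

    -- The leftover block `ws` makes this usable for covers by three and by four disjoint parts.
    disjoint-adjacent : ∀ xs ys zs {ws x y z} → Unique (xs ++ ys ++ zs ++ ws) →
      x ∈ xs → y ∈ ys → z ∈ zs → x ~ y ⊎ x ~ z ⊎ y ~ z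
    disjoint-adjacent xs ys zs u x∈ y∈ z∈ = triple-adjacent α≤2
      (Unique-++⇒≢ u x∈ (∈-++⁺ˡ y∈))
      (Unique-++⇒≢ u x∈ (∈-++⁺ʳ ys (∈-++⁺ˡ z∈)))
      (Unique-++⇒≢ (Unique-++ʳ xs u) y∈ (∈-++⁺ˡ z∈))

    -- Two of the three starts are adjacent because α ≤ 2; the six possible arcs are `reduce-arc` up
    -- to relabelling.
    threeReduce : ∀ n → ThreeReduce n
    threeReduce zero    {vs = []} len u p q r π with uncons p
    ... | _ , refl with () ← ↭-length π
    threeReduce (suc n) {as = as} {bs} {cs} len u p q r π
      with disjoint-adjacent as bs cs {ws = []} u′ (start∈ p) (start∈ q) (start∈ r)
      where
      u′ = Unique-resp-↭ (↭-trans (↭-sym π)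
        (solve 3 (λ a b c → a ⊕ b ⊕ c ⊜ a ⊕ b ⊕ c ⊕ id) ↭-refl as bs cs)) u
    ... | inj₁ (fwd e) = reduce-arc (threeReduce n) e len u p q r π
    ... | inj₁ (bwd e) = swap₁₂ (reduce-arc (threeReduce n) e len u q p r
      (↭-trans (solve 3 (λ a b c → b ⊕ a ⊕ c ⊜ a ⊕ b ⊕ c) ↭-refl as bs cs) π))
    ... | inj₂ (inj₁ (fwd e)) = swap₂₃ (reduce-arc (threeReduce n) e len u p r q
      (↭-trans (solve 3 (λ a b c → a ⊕ c ⊕ b ⊜ a ⊕ b ⊕ c) ↭-refl as bs cs) π))
    ... | inj₂ (inj₁ (bwd e)) = swap₂₃ (swap₁₂ (reduce-arc (threeReduce n) e len u r p q
      (↭-trans (solve 3 (λ a b c → c ⊕ a ⊕ b ⊜ a ⊕ b ⊕ c) ↭-refl as bs cs) π)))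
    ... | inj₂ (inj₂ (fwd e)) = swap₁₂ (swap₂₃ (reduce-arc (threeReduce n) e len u q r p
      (↭-trans (solve 3 (λ a b c → b ⊕ c ⊕ a ⊜ a ⊕ b ⊕ c) ↭-refl as bs cs) π)))
    ... | inj₂ (inj₂ (bwd e)) = swap₁₂ (swap₂₃ (swap₁₂ (reduce-arc (threeReduce n) e len u r q p
      (↭-trans (solve 3 (λ a b c → c ⊕ b ⊕ a ⊜ a ⊕ b ⊕ c) ↭-refl as bs cs) π))))

    -- Vertices are added one at a time, each as a third dipath that is then merged away.
    -- `Spanned 0` covers the case of a single vertex, since a dipath is never empty.
    dipathCover : ∀ v vs → Unique (v ∷ vs) →
      Spanned 0 (v ∷ vs) ⊎ ∃[ x ] ∃[ y ] TwoDipaths x y (v ∷ vs)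
    dipathCover v []       u          = inj₁ (_ , _ , _ , point v , ↭-refl)
    dipathCover v (w ∷ ws) u@(_ ∷ u′) with dipathCover w ws u′
    ... | inj₁ (_ , _ , _ , p , π) = inj₂ (_ , _ , twoDipaths (point v) p (↭-prep v π))
    ... | inj₂ (_ , _ , twoDipaths p q π)
      with threeReduce _ refl u (point v) p q (↭-prep v π)
    ...   | inj₁ t        = inj₂ (_ , _ , t)
    ...   | inj₂ (inj₁ t) = inj₂ (_ , _ , t)
    ...   | inj₂ (inj₂ t) = inj₂ (_ , _ , t)

  -- Rotating a dipath with adjacent ends, and an arc between the two parts.

  endAt : ∀ {x y v xs} → Dipath x y xs → v ∈ xs → v ≡ y ⊎
    ∃[ w ] ∃[ ys ] ∃[ zs ] (Dipath x v ys × Dipath w y zs × zs ++ ys ↭ xs)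
  endAt (point _) (here refl) = inj₁ refl
  endAt (e ∷ p)   (here refl) = inj₂ (_ , _ , _ , point _ , p , ++-comm _ [ _ ])
  endAt (e ∷ p)   (there v∈) with endAt p v∈
  ... | inj₁ refl = inj₁ refl
  ... | inj₂ (_ , ys , zs , p₁ , p₂ , π) =
    inj₂ (_ , _ , _ , e ∷ p₁ , p₂ , ↭-trans (shift _ zs ys) (↭-prep _ π))

  startAt : ∀ {x y v xs} → Dipath x y xs → v ∈ xs → v ≡ x ⊎
    ∃[ w ] ∃[ ys ] ∃[ zs ] (Dipath x w ys × Dipath v y zs × zs ++ ys ↭ xs)
  startAt p       v∈ with p | v∈
  ... | point _ | here refl = inj₁ refl
  ... | e ∷ _   | here refl = inj₁ refl
  ... | e ∷ p′  | there v∈′ with startAt p′ v∈′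
  ...   | inj₁ refl = inj₂ (_ , _ , _ , point _ , p′ , ++-comm _ [ _ ])
  ...   | inj₂ (_ , ys , zs , p₁ , p₂ , π) =
    inj₂ (_ , _ , _ , e ∷ p₁ , p₂ , ↭-trans (shift _ zs ys) (↭-prep _ π))

  -- Both directions are asked for, because the arc found between the two dipaths may leave either
  -- of them.
  record Rotatable (xs : List Vertex) : Set where
    field
      toEnd   : ∀ {v} → v ∈ xs → ∃[ x ] ∃[ ys ] (Trail 1 x v ys × ys ↭ xs)
      toStart : ∀ {v} → v ∈ xs → ∃[ y ] ∃[ ys ] (Trail 1 v y ys × ys ↭ xs)

  open Rotatable

  singleton-rotatable : ∀ x → Rotatable [ x ]
  singleton-rotatable x .toEnd   (here refl) = _ , _ , point x , ↭-refl
  singleton-rotatable x .toStart (here refl) = _ , _ , point x , ↭-refl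

  -- The dipath is cut at `v` and its later piece is traversed first; the edge `y ~ x` joins the
  -- pieces and is the only one that may be backward.
  closed⇒rotatable : ∀ {x y xs} → Dipath x y xs → y ~ x → Rotatable xs
  closed⇒rotatable p y~x .toEnd v∈ with endAt p v∈
  ... | inj₁ refl                      = _ , _ , weaken z≤n p , ↭-refl
  ... | inj₂ (_ , _ , _ , p₁ , p₂ , π) = _ , _ , p₂ ⟨ y~x ⟩~ p₁ , π
  closed⇒rotatable p y~x .toStart v∈ with startAt p v∈
  ... | inj₁ refl                      = _ , _ , weaken z≤n p , ↭-refl
  ... | inj₂ (_ , _ , _ , p₁ , p₂ , π) = _ , _ , p₂ ⟨ y~x ⟩~ p₁ , π

  -- A walk from `xs` to `ys` has a first step that leaves `xs`, and everything outside `xs` lies in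
  -- `ys`.
  bridge : ∀ {xs ys} → Unique (xs ++ ys) → (∀ v → v ∈ xs ++ ys) → ∀ {x y} →
    Star _~_ x y → x ∈ xs → y ∈ ys → ∃[ u ] ∃[ v ] (u ∈ xs × v ∈ ys × u ~ v)
  bridge uniq all ε x∈ y∈ = contradiction refl (Unique-++⇒≢ uniq x∈ y∈)
  bridge {xs} uniq all (_◅_ {j = z} e es) x∈ y∈ with ∈-++⁻ xs (all z)
  ... | inj₁ z∈ = bridge uniq all es z∈ y∈
  ... | inj₂ z∈ = _ , _ , x∈ , z∈ , e

  -- Exchanging ends between the two middle dipaths.

  Prefix : List Vertex → Vertex → Set
  Prefix ss v = ∀ {y ys} → Dipath v y ys → ∃[ s ] Dipath s y (ss ++ ys)

  Suffix : List Vertex → Vertex → Set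
  Suffix ts v = ∀ {x xs} → Dipath x v xs → ∃[ t ] Dipath x t (xs ++ ts)

  module _ (α≤2 : α D ≤ 2) (vs : List Vertex) (uniq : Unique vs) where

    Joinable : ℕ → Set
    Joinable n = ∀ {a a′ b b′ as bs} → length as ≤ n →
      Dipath a a′ as → Dipath b b′ bs → as ++ bs ↭ vs → Spanned 2 vs

    -- The bound `suc n` is chosen so that A minus one vertex falls under `Joinable n`, which leaves
    -- the second dipath unbounded and able to absorb S and T.
    SandwichJoinable : ℕ → ℕ → Set
    SandwichJoinable n m = ∀ {s s′ a a′ b b′ t t′ ss as bs ts} →
      length as ≤ suc n → length bs ≤ m →
      Dipath s s′ ss → s′ ⟶ a → s′ ⟶ b → Dipath a a′ as → Dipath b b′ bs →
      a′ ⟶ t → b′ ⟶ t → Dipath t t′ ts → ss ++ as ++ bs ++ ts ↭ vs → Spanned 2 vs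

    atMostTwo : ∀ {k x y xs} → k ≤ 2 → Trail k x y xs → xs ↭ vs → Spanned 2 vs
    atMostTwo k≤2 p π = _ , _ , _ , weaken k≤2 p , π

    -- The descent is lexicographic: an end of A is dropped and B absorbs S and T, or A stays and B
    -- gives its ends to S and T. `Prefix` and `Suffix` are operations rather than dipaths, so that
    -- S and T may be empty.
    squeeze : ∀ {n m} → Joinable n → SandwichJoinable n m → ∀ {a a′ b b′ as bs} ss ts →
      length as ≤ suc n → length bs ≤ suc m →
      Prefix ss a → Prefix ss b → Dipath a a′ as → Dipath b b′ bs → Suffix ts a′ → Suffix ts b′ →
      a ~ b → a′ ~ b′ → ss ++ as ++ bs ++ ts ↭ vs → Spanned 2 vs
    squeeze ih ih′ ss ts _ _ Pa Pb (point _) q Qa Qb (fwd a⟶b) _ π =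
      atMostTwo z≤n (proj₂ (Pa (a⟶b ∷ proj₂ (Qb q)))) π
    squeeze ih ih′ {bs = bs} ss ts (s≤s len) _ Pa Pb (_∷_ {xs = as} e p) q Qa Qb (fwd a⟶b) _ π =
      ih len p (proj₂ (Pa (a⟶b ∷ proj₂ (Qb q))))
        (↭-trans (solve 5 (λ s h a b t → a ⊕ s ⊕ h ⊕ b ⊕ t ⊜ s ⊕ (h ⊕ a) ⊕ b ⊕ t) ↭-refl
          ss [ _ ] as bs ts) π)
    squeeze ih ih′ {bs = bs} ss ts len _ Pa Pb p q Qa Qb (bwd _) (bwd b′⟶a′) π with initLast p
    ... | single refl = atMostTwo z≤n (proj₂ (Pb (proj₂ (Qa (q ⟨ b′⟶a′ ⟩ point _)))))
        (↭-trans (solve 4 (λ s a b t → s ⊕ (b ⊕ a) ⊕ t ⊜ s ⊕ a ⊕ b ⊕ t) ↭-refl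
          ss [ _ ] bs ts) π)
    ... | snoc {xs = as} p′ _ =
      ih (length-init as len) p′ (proj₂ (Pb (proj₂ (Qa (q ⟨ b′⟶a′ ⟩ point _)))))
        (↭-trans (solve 5 (λ s h a b t → a ⊕ s ⊕ (b ⊕ h) ⊕ t ⊜ s ⊕ (a ⊕ h) ⊕ b ⊕ t) ↭-refl
          ss [ _ ] as bs ts) π)
    squeeze ih ih′ {as = as} ss ts len len′ Pa Pb p q Qa Qb (bwd b⟶a) (fwd a′⟶b′) π with peel q
    ... | one refl = atMostTwo z≤n (proj₂ (Pb (b⟶a ∷ proj₂ (Qa p))))
        (↭-trans (solve 4 (λ s a b t → s ⊕ b ⊕ a ⊕ t ⊜ s ⊕ a ⊕ b ⊕ t) ↭-refl
          ss as [ _ ] ts) π)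
    ... | two _ = atMostTwo z≤n (proj₂ (Pb (b⟶a ∷ proj₂ (Qb (p ⟨ a′⟶b′ ⟩ point _)))))
        (↭-trans (solve 5 (λ s a b c t → s ⊕ b ⊕ (a ⊕ c) ⊕ t ⊜ s ⊕ a ⊕ (b ⊕ c) ⊕ t) ↭-refl
          ss as [ _ ] [ _ ] ts) π)
    ... | many {ms = ms} e q′ f =
      -- B loses two vertices while the induction asks for one; `n≤1+n` gives up the surplus.
      ih′ len (length-init ms (≤-trans (s≤s⁻¹ len′) (n≤1+n _)))
        (proj₂ (Pb (point _))) b⟶a e p q′ a′⟶b′ f (proj₂ (Qb (point _)))
        (↭-trans (solve 6 (λ s a b m c t → (s ⊕ b) ⊕ a ⊕ m ⊕ c ⊕ t ⊜ s ⊕ a ⊕ (b ⊕ m ⊕ c) ⊕ t) ↭-refl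
          ss as [ _ ] ms [ _ ] ts) π)

    sandwichJoinable : ∀ {n} → Joinable n → ∀ m → SandwichJoinable n m
    sandwichJoinable ih zero    len len′ S s→a s→b p q a→t b→t T π
      with uncons q
    ... | _ , refl with () ← len′
    sandwichJoinable ih (suc m) {ss = ss} {as} {bs} {ts} len len′ S s→a s→b p q a→t b→t T π
      -- The triples are the starts of A and B with the end of T, and the ends of A and B with the
      -- start of S.
      with disjoint-adjacent α≤2 as bs ts {ws = ss} (Unique-resp-↭ (↭-sym (↭-trans
             (solve 4 (λ s a b t → a ⊕ b ⊕ t ⊕ s ⊜ s ⊕ a ⊕ b ⊕ t) ↭-refl ss as bs ts) π)) uniq)
             (start∈ p) (start∈ q) (end∈ T)
         | disjoint-adjacent α≤2 as bs ss {ws = ts} (Unique-resp-↭ (↭-sym (↭-trans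
             (solve 4 (λ s a b t → a ⊕ b ⊕ s ⊕ t ⊜ s ⊕ a ⊕ b ⊕ t) ↭-refl ss as bs ts) π)) uniq)
             (end∈ p) (end∈ q) (start∈ S)
    ... | inj₂ (inj₁ a~t) | _ = atMostTwo (s≤s z≤n) ((S ⟨ s→b ⟩ q ⟨ b→t ⟩ T) ⟨ ~-sym a~t ⟩~ p)
      (↭-trans (solve 4 (λ s a b t → (s ⊕ b ⊕ t) ⊕ a ⊜ s ⊕ a ⊕ b ⊕ t) ↭-refl ss as bs ts) π)
    ... | inj₂ (inj₂ b~t) | _ = atMostTwo (s≤s z≤n) ((S ⟨ s→a ⟩ p ⟨ a→t ⟩ T) ⟨ ~-sym b~t ⟩~ q)
      (↭-trans (solve 4 (λ s a b t → (s ⊕ a ⊕ t) ⊕ b ⊜ s ⊕ a ⊕ b ⊕ t) ↭-refl ss as bs ts) π)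
    ... | inj₁ _ | inj₂ (inj₁ a~s) = atMostTwo (s≤s z≤n) (p ⟨ a~s ⟩~ (S ⟨ s→b ⟩ q ⟨ b→t ⟩ T))
      (↭-trans (solve 4 (λ s a b t → a ⊕ s ⊕ b ⊕ t ⊜ s ⊕ a ⊕ b ⊕ t) ↭-refl ss as bs ts) π)
    ... | inj₁ _ | inj₂ (inj₂ b~s) = atMostTwo (s≤s z≤n) (q ⟨ b~s ⟩~ (S ⟨ s→a ⟩ p ⟨ a→t ⟩ T))
      (↭-trans (solve 4 (λ s a b t → b ⊕ s ⊕ a ⊕ t ⊜ s ⊕ a ⊕ b ⊕ t) ↭-refl ss as bs ts) π)
    ... | inj₁ a~b | inj₁ a′~b′ = squeeze ih (sandwichJoinable ih m) ss ts len len′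
      (λ r → _ , S ⟨ s→a ⟩ r) (λ r → _ , S ⟨ s→b ⟩ r) p q
      (λ r → _ , r ⟨ a→t ⟩ T) (λ r → _ , r ⟨ b→t ⟩ T) a~b a′~b′ π

    data Ends (a a′ b b′ : Vertex) (as : List Vertex) : Set where
      closed   : Rotatable as → Ends a a′ b b′ as
      linkable : a′ ~ b ⊎ b′ ~ a → Ends a a′ b b′ as
      parallel : a ~ b → a′ ~ b′ → Ends a a′ b b′ as

    ends : ∀ {a a′ b b′ as bs} → Dipath a a′ as → Dipath b b′ bs → as ++ bs ↭ vs → Ends a a′ b b′ as
    ends (point _) q π = closed (singleton-rotatable _)
    ends p₀@(_∷_ {x = a} {xs = as} e p) q π
      -- Both triples contain the two ends of the first dipath, which are distinct as it has at
      -- least two vertices; the third vertex is the end, then the start, of the second dipath.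
      with disjoint-adjacent α≤2 [ a ] as _ {ws = []} u (here refl) (end∈ p) (end∈ q)
         | disjoint-adjacent α≤2 [ a ] as _ {ws = []} u (here refl) (end∈ p) (start∈ q)
      where
      u = Unique-resp-↭ (↭-trans (↭-sym π)
        (↭-reflexive (cong (λ l → a ∷ as ++ l) (sym (++-identityʳ _))))) uniq
    ... | inj₁ a~a′         | _                 = closed (closed⇒rotatable p₀ (~-sym a~a′))
    ... | inj₂ (inj₁ a~b′)  | _                 = linkable (inj₂ (~-sym a~b′))
    ... | inj₂ (inj₂ _)     | inj₁ a~a′         = closed (closed⇒rotatable p₀ (~-sym a~a′))
    ... | inj₂ (inj₂ _)     | inj₂ (inj₂ a′~b)  = linkable (inj₁ a′~b)
    ... | inj₂ (inj₂ a′~b′) | inj₂ (inj₁ a~b)   = parallel a~b a′~b′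

    rotate : ∀ {x y xs ys} → Rotatable xs → Rotatable ys → x ∈ xs → y ∈ ys → x ⟶ y →
      xs ++ ys ↭ vs → Spanned 2 vs
    rotate R S x∈ y∈ x⟶y π with toEnd R x∈ | toStart S y∈
    ... | _ , _ , p , πˣ | _ , _ , q , πʸ = atMostTwo ≤-refl (p ⟨ x⟶y ⟩ q) (↭-trans (++⁺ πˣ πʸ) π)

    -- Joining two dipaths into a Hamilton orpath.

    module _ (conn : Connected D) (all : ∀ v → v ∈ vs) where

      unrestricted : ∀ {v} → Suffix [] v
      unrestricted {xs = xs} p = _ , subst (Trail 0 _ _) (sym (++-identityʳ xs)) p

      joinable : ∀ n → Joinable n
      joinable zero    len p q π with uncons p
      ... | _ , refl with () ← len
      joinable (suc n) {a} {a′} {b} {b′} {as} {bs} len p q π =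
        dispatch (ends p q π) (ends q p π′)
        where
        π′ = ↭-trans (++-comm bs as) π

        squeezed : a ~ b → a′ ~ b′ → Spanned 2 vs
        -- The bound for B is its current length, chosen afresh at each call, so B may have grown
        -- while A shrank.
        squeezed a~b a′~b′ = squeeze (joinable n) (sandwichJoinable (joinable n) (length bs))
          [] [] len (n≤1+n _) (λ r → _ , r) (λ r → _ , r) p q unrestricted unrestricted a~b a′~b′
          (↭-trans (↭-reflexive (cong (as ++_) (++-identityʳ bs))) π)

        dispatch : Ends a a′ b b′ as → Ends b b′ a a′ bs → Spanned 2 vs
        dispatch (linkable (inj₁ a′~b)) _ = atMostTwo (s≤s z≤n) (p ⟨ a′~b ⟩~ q) π
        dispatch (linkable (inj₂ b′~a)) _ = atMostTwo (s≤s z≤n) (q ⟨ b′~a ⟩~ p) π′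
        dispatch _ (linkable (inj₁ b′~a)) = atMostTwo (s≤s z≤n) (q ⟨ b′~a ⟩~ p) π′
        dispatch _ (linkable (inj₂ a′~b)) = atMostTwo (s≤s z≤n) (p ⟨ a′~b ⟩~ q) π
        dispatch (parallel a~b a′~b′) _   = squeezed a~b a′~b′
        dispatch _ (parallel b~a b′~a′)   = squeezed (~-sym b~a) (~-sym b′~a′)
        dispatch (closed R) (closed S)
          with bridge (Unique-resp-↭ (↭-sym π) uniq) (λ v → ∈-resp-↭ (↭-sym π) (all v))
                 (conn a b) (start∈ p) (start∈ q)
        ... | _ , _ , x∈ , y∈ , fwd x⟶y = rotate R S x∈ y∈ x⟶y π
        ... | _ , _ , x∈ , y∈ , bwd y⟶x = rotate S R y∈ x∈ y⟶x π′

  hamiltonOrpath : Connected D → α D ≤ 2 → ∃[ P ] (Hamilton D P × backwardArcs D P ≤ 2)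
  hamiltonOrpath conn α≤2 = fromVertices (allFin order) (allFin⁺ order) ∈-allFin
    where
    fromSpanned : ∀ {vs} → Unique vs → (∀ v → v ∈ vs) → Spanned 2 vs →
      ∃[ P ] (Hamilton D P × backwardArcs D P ≤ 2)
    fromSpanned uniq all (_ , _ , xs , p , π) = record
      { vertices = xs
      ; distinct = Unique-resp-↭ (↭-sym π) uniq
      ; linked   = trail⇒linked p
      } , (λ v → ∈-resp-↭ (↭-sym π) (all v)) , trail⇒countBackward p

    fromVertices : ∀ vs → Unique vs → (∀ v → v ∈ vs) →
      ∃[ P ] (Hamilton D P × backwardArcs D P ≤ 2)
    -- In the digraph without vertices the empty orpath is Hamilton.
    fromVertices []       uniq all =
      record { vertices = [] ; distinct = [] ; linked = [] } , all , z≤n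
    fromVertices (v ∷ vs) uniq all with dipathCover α≤2 v vs uniq
    ... | inj₁ (_ , _ , _ , p , π) = fromSpanned uniq all (_ , _ , _ , weaken z≤n p , π)
    ... | inj₂ (_ , _ , twoDipaths p q π) =
      fromSpanned uniq all (joinable α≤2 (v ∷ vs) uniq conn all _ ≤-refl p q π)

  -- Exhaustive search for orpaths with few backward arcs.

  Sparse : ℕ → List Vertex → Set
  Sparse k xs = Unique xs × Linked _~_ xs × countBackward D xs < k

  sparse? : ∀ k xs → Dec (Sparse k xs)
  sparse? k xs = unique? xs ×-dec linked? Adjacent? xs ×-dec (countBackward D xs <? k)
    where open import Data.List.Relation.Unary.Unique.DecPropositional (_≟ᶠ_ {order}) using (unique?)

  sparse-tail : ∀ {k x} xs → Sparse k (x ∷ xs) → Sparse k xs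
  sparse-tail []       (_ ∷ u , _ , lt) = u , [] , ≤-trans (s≤s z≤n) lt
  sparse-tail (y ∷ xs) (_ ∷ u , l , lt) = u , Linked.tail l , ≤-trans (s≤s (m≤n+m _ _)) lt

  -- Lists grow by prepending a vertex and are pruned at every length; nothing is lost, because
  -- tails of sparse lists are sparse.
  sparseOrpaths : ℕ → ℕ → List (List Vertex)
  sparseOrpaths k zero    = [ [] ]
  sparseOrpaths k (suc n) =
    filter (sparse? k) (cartesianProductWith _∷_ (allFin order) (sparseOrpaths k n))

  sparseOrpaths-complete : ∀ {k} xs → Sparse k xs → xs ∈ sparseOrpaths k (length xs)
  sparseOrpaths-complete []       s = here refl
  sparseOrpaths-complete (x ∷ xs) s = ∈-filter⁺ (sparse? _)
    (∈-cartesianProductWith⁺ _∷_ (∈-allFin x) (sparseOrpaths-complete xs (sparse-tail xs s))) s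

  -- A longer sparse list would have a tail of length exactly `n`.
  sparse-short : ∀ {k n} → sparseOrpaths k n ≡ [] → ∀ xs → Sparse k xs → ¬ (n ≤ length xs)
  sparse-short {n = n} eq xs s n≤ with m≤n⇒m<n∨m≡n n≤
  sparse-short eq xs       s _ | inj₂ refl with () ← subst (xs ∈_) eq (sparseOrpaths-complete xs s)
  sparse-short eq (x ∷ xs) s _ | inj₁ (s≤s n≤) = sparse-short eq xs (sparse-tail xs s) n≤

  -- Mapping each vertex to a position at which it occurs is injective.
  hamilton-long : ∀ {xs : List Vertex} → (∀ x → x ∈ xs) → order ≤ length xs
  hamilton-long h = injective⇒≤ {f = λ x → index (h x)}
    (λ {x} {y} → index-injective (setoid Vertex) (h x) (h y))

-- The sharpness example.

barbellArc : Fin 6 → Fin 6 → Bool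
barbellArc 0F 1F = true
barbellArc 0F 2F = true
barbellArc 1F 2F = true
barbellArc 3F 4F = true
barbellArc 3F 5F = true
barbellArc 4F 5F = true
-- The only arc between the two triangles; it joins their middle vertices.
barbellArc 1F 4F = true
barbellArc _  _  = false

barbell : Digraph
barbell = record
  { order  = 6
  ; _⟶_    = λ x y → T (barbellArc x y)
  ; _⟶?_   = λ x y → T? (barbellArc x y)
  ; irrefl = λ { {0F} refl () ; {1F} refl () ; {2F} refl ()
               ; {3F} refl () ; {4F} refl () ; {5F} refl () }
  }

barbell-connected : Connected barbell
barbell-connected x y = toHub x ◅◅ reverse (symmetric _) (toHub y)
  where
  toHub : ∀ x → Star (Adjacent barbell) x 1F
  toHub 0F = fwd tt ◅ ε
  toHub 1F = ε
  toHub 2F = bwd tt ◅ ε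
  toHub 3F = fwd tt ◅ toHub 4F
  toHub 4F = bwd tt ◅ ε
  toHub 5F = bwd tt ◅ toHub 4F

-- An independent set takes at most one vertex from each triangle; the bound is checked by
-- evaluating `α`.
barbell-α : α barbell ≤ 2
barbell-α = toWitness {a? = α barbell ≤? 2} tt

barbell-sharp : ¬ (∃[ P ] (Hamilton barbell P × backwardArcs barbell P < 2))
-- Here `refl` runs the search: no orpath on six vertices has fewer than two backward arcs.
barbell-sharp (P , h , lt) = sparse-short barbell refl (vertices P)
  (distinct P , linked P , lt) (hamilton-long barbell h)
  where open Orpath

theorem1p2 : ((D : Digraph) → Connected D → α D ≤ 2 →
    ∃[ P ] (Hamilton D P × backwardArcs D P ≤ 2))
    × (∃[ D ] (Connected D × α D ≤ 2 ×
    ¬ (∃[ P ] (Hamilton D P × backwardArcs D P < 2))))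
theorem1p2 = hamiltonOrpath , barbell , barbell-connected , barbell-α , barbell-sharp
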